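{- Let $n \ge 4$ be an even integer and let $T_{2n}(W)$ be the Toeplitz graph with vertex set $\{x_1,\dots,x_{2n}\}$ in which $x_i$ and $x_j$ are adjacent if and only if $|i-j|$ is odd or $|i-j| = n$. Let $k$ be an integer with $1 < k \le \frac{n}{2}-1$. Then the $k$-domination number satisfies $\gamma_k(T_{2n}(W)) = 2k$.
   Context: $T_{2n}(W)$ is defined from $W = \{x_1, x_3, \dots, x_{2n-1}\} \cup \{x_n\}$: distinct vertices $x_i, x_j$ ($1\le i,j\le 2n$) are adjacent iff $|i-j| = t$ for some $x_t \in W$, i.e. iff $|i-j|$ is odd or equals $n$. For a graph $G$ and an integer $k\ge 1$, a subset $D \subseteq V(G)$ is a $k$-dominating set if every vertex of $V(G)\setminus D$ has at least $k$ neighbors in $D$. The $k$-domination number $\gamma_k(G)$ is the minimum cardinality of a $k$-dominating set of $G$. -}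

module Defs where

open import Level using (0ℓ)
open import Data.Nat using (ℕ; _*_; _≤_; _<_; ∣_-_∣; _≤?_; _<?_; _≟_)
open import Data.Nat.Properties using (∣-∣-comm; ≮⇒≥)
open import Data.Nat.Divisibility using (_∤_; _∣?_)
open import Data.Nat.Induction using (Acc; acc; <-wellFounded)
open import Data.Fin using (Fin; toℕ)
import Data.Fin.Properties as Fin
open import Data.Fin.Subset using (Subset; _∈_; _∉_; _∩_; ⊤; ∣_∣)
open import Data.Fin.Subset.Properties using (anySubset?; _∈?_; ∈⊤)
open import Data.Product using (_×_; _,_; ∃; proj₁; proj₂)
open import Data.Sum using (_⊎_)
open import Data.Vec using (tabulate)
open import Relation.Binary using (Rel; Symmetric; Decidable)
open import Relation.Binary.PropositionalEquality using (_≡_; _≢_; refl; subst)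
open import Relation.Nullary using (¬_; yes; no; does; ¬?; contradiction)
open import Relation.Nullary.Decidable using (_×-dec_; _⊎-dec_; _→-dec_)
import Relation.Unary as U

record Graph (m : ℕ) : Set₁ where
  field
    Adj   : Rel (Fin m) 0ℓ
    adj?  : Decidable Adj
    adj-sym : Symmetric Adj
    adj-irrefl : ∀ {v} → ¬ Adj v v

  neighbours : Fin m → Subset m
  neighbours v = tabulate (λ w → does (adj? v w))

open Graph public

module _ {m : ℕ} (G : Graph m) (k : ℕ) where

  KDominating : Subset m → Set
  KDominating D = ∀ v → v ∉ D → k ≤ ∣ neighbours G v ∩ D ∣

  kDominating? : U.Decidable KDominating
  kDominating? D =
    Fin.all? λ v → ¬? (v ∈? D) →-dec (k ≤? ∣ neighbours G v ∩ D ∣)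

  IsKDominationNumber : ℕ → Set
  IsKDominationNumber c =
    (∃ λ D → KDominating D × ∣ D ∣ ≡ c) × (∀ D → KDominating D → c ≤ ∣ D ∣)

  private
    descend : ∀ D → KDominating D → Acc _<_ ∣ D ∣ → ∃ IsKDominationNumber
    descend D dom (acc rec)
      with anySubset? (λ E → kDominating? E ×-dec (∣ E ∣ <? ∣ D ∣))
    ... | yes (E , domE , E<D) = descend E domE (rec E<D)
    ... | no ¬smaller =
      ∣ D ∣ , (D , dom , refl) , λ E domE → ≮⇒≥ λ E<D → ¬smaller (E , domE , E<D)

  -- The whole vertex set is always k-dominating, so a minimum exists.
  kDominationNumber-exists : ∃ IsKDominationNumber
  kDominationNumber-exists =
    descend ⊤ (λ _ v∉⊤ → contradiction ∈⊤ v∉⊤) (<-wellFounded _)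

  γ : ℕ
  γ = proj₁ kDominationNumber-exists

  γ-isKDominationNumber : IsKDominationNumber γ
  γ-isKDominationNumber = proj₂ kDominationNumber-exists

-- The Toeplitz graph T_m(W).  The vertex x_i (1 ≤ i ≤ m) is the element of
-- Fin m whose value is i − 1; the shift does not affect |i − j|.  W is given
-- as the set of indices t with x_t ∈ W; only 1 ≤ t < m plays a role, since
-- |i − j| lies in that range for distinct vertices.
toeplitz : (m : ℕ) {W : U.Pred ℕ 0ℓ} → U.Decidable W → Graph m
toeplitz m {W} W? = record
  { Adj    = λ i j → i ≢ j × W ∣ toℕ i - toℕ j ∣
  ; adj?   = λ i j → ¬? (i Fin.≟ j) ×-dec W? ∣ toℕ i - toℕ j ∣
  ; adj-sym = λ {i} {j} (i≢j , w) →
               (λ { refl → i≢j refl }) , subst W (∣-∣-comm (toℕ i) (toℕ j)) w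
  ; adj-irrefl = λ (v≢v , _) → v≢v refl
  }

OddOr : ℕ → U.Pred ℕ 0ℓ
OddOr n t = 2 ∤ t ⊎ t ≡ n

oddOr? : ∀ n → U.Decidable (OddOr n)
oddOr? n t = ¬? (2 ∣? t) ⊎-dec (t ≟ n)

T : (n : ℕ) → Graph (2 * n)
T n = toeplitz (2 * n) (oddOr? n)

{-# OPTIONS --safe #-}

-- As n is even, T_{2n}(W) is the complete bipartite graph between the two
-- parity classes together with the perfect matching {v, v + n}, whose edges
-- stay inside a class.  The first 2k vertices contain k vertices of each class,
-- hence are k-dominating.  Conversely, let D be k-dominating and suppose that D
-- has fewer than k vertices in one class, say b.  A vertex of the other class
-- outside D needs its partner in D, so b ≥ k − 1 if there is such a vertex;
-- moreover D meets each of the n/2 ≥ k + 1 matching edges of that class.  Hence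
-- |D| ≥ (k − 1) + (k + 1).  If there is no such vertex, then |D| ≥ n ≥ 2k.

module Submission where

open import Defs
open import Data.Nat using (ℕ; _*_; _∸_; _/_; _≤_; _<_)
open import Data.Nat.Divisibility using (_∣_)
open import Relation.Binary.PropositionalEquality using (_≡_)

open import Data.Nat
  using (zero; suc; _+_; ∣_-_∣; z≤n; s≤s; s≤s⁻¹; _<?_; _≤?_; parity) renaming (_≟_ to _≟ℕ_)
open import Data.Nat.Properties
open import Data.Nat.Divisibility using (divides; ∣m∣n⇒∣m+n; ∣m+n∣m⇒∣n; ∣-refl)
open import Data.Nat.DivMod using (m*n/n≡m)
open import Data.Fin using (Fin; zero; suc; toℕ; _↑ˡ_; _↑ʳ_)
import Data.Fin.Properties as Fin
open import Data.Fin.Subset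
  using (Subset; inside; outside; _∈_; _∉_; _⊆_; _∩_; _∪_; ⁅_⁆; ∣_∣)
open import Data.Fin.Subset.Properties
  using (_∈?_; p⊆q⇒∣p∣≤∣q∣; x∈p∩q⁺; x∈p∩q⁻; x∈p∪q⁺; x∈⁅x⁆; ∣⁅x⁆∣≡1; drop-there)
open import Data.Parity using (Parity; 0ℙ; 1ℙ; _⁻¹) renaming (_+_ to _⊕_)
import Data.Parity.Properties as ℙ
open import Data.Product using (_×_; _,_; proj₁; proj₂)
open import Data.Sum using (_⊎_; inj₁; inj₂)
open import Data.Vec using ([]; _∷_; _++_; tabulate; splitAt; here; there)
open import Data.Vec.Properties
  using ([]=⇒lookup; lookup⇒[]=; lookup∘tabulate; lookup-++ˡ; lookup-++ʳ)
open import Function using (_∘_; case_of_)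
open import Level using (0ℓ)
open import Relation.Binary.PropositionalEquality
  using (refl; sym; trans; cong; cong₂; subst)
open import Relation.Nullary using (¬_; yes; no; does; ¬?; contradiction)
open import Relation.Nullary.Decidable using (_×-dec_; dec-true; decidable-stable)
import Relation.Unary as U

private variable
  m n k : ℕ

-- Finite subsets and their cardinalities.

comprehension : {P : U.Pred (Fin m) 0ℓ} → U.Decidable P → Subset m
comprehension P? = tabulate (does ∘ P?)

module _ {P : U.Pred (Fin m) 0ℓ} (P? : U.Decidable P) where

  ∈-comprehension⁺ : ∀ {v} → P v → v ∈ comprehension P?
  ∈-comprehension⁺ {v} Pv =
    lookup⇒[]= v _ (trans (lookup∘tabulate (does ∘ P?) v) (dec-true (P? v) Pv))

  ∈-comprehension⁻ : ∀ {v} → v ∈ comprehension P? → P v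
  ∈-comprehension⁻ {v} v∈
    with P? v | trans (sym (lookup∘tabulate (does ∘ P?) v)) ([]=⇒lookup v∈)
  ... | yes Pv | _  = Pv
  ... | no  _  | ()

∣p∪q∣≤∣p∣+∣q∣ : (p q : Subset m) → ∣ p ∪ q ∣ ≤ ∣ p ∣ + ∣ q ∣
∣p∪q∣≤∣p∣+∣q∣ [] [] = z≤n
∣p∪q∣≤∣p∣+∣q∣ (outside ∷ p) (outside ∷ q) = ∣p∪q∣≤∣p∣+∣q∣ p q
∣p∪q∣≤∣p∣+∣q∣ (outside ∷ p) (inside  ∷ q) =
  ≤-trans (s≤s (∣p∪q∣≤∣p∣+∣q∣ p q)) (≤-reflexive (sym (+-suc ∣ p ∣ ∣ q ∣)))
∣p∪q∣≤∣p∣+∣q∣ (inside  ∷ p) (outside ∷ q) = s≤s (∣p∪q∣≤∣p∣+∣q∣ p q)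
∣p∪q∣≤∣p∣+∣q∣ (inside  ∷ p) (inside  ∷ q) =
  s≤s (≤-trans (∣p∪q∣≤∣p∣+∣q∣ p q) (+-monoʳ-≤ ∣ p ∣ (n≤1+n ∣ q ∣)))

disjoint⇒∣p∣+∣q∣≤∣r∣ : (p q r : Subset m) → p ⊆ r → q ⊆ r →
                       (∀ {v} → v ∈ p → v ∉ q) → ∣ p ∣ + ∣ q ∣ ≤ ∣ r ∣
disjoint⇒∣p∣+∣q∣≤∣r∣ [] [] [] _ _ _ = z≤n
disjoint⇒∣p∣+∣q∣≤∣r∣ (x ∷ p) (y ∷ q) (z ∷ r) p⊆r q⊆r p#q
  with rec ← disjoint⇒∣p∣+∣q∣≤∣r∣ p q r
               (drop-there ∘ p⊆r ∘ there) (drop-there ∘ q⊆r ∘ there)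
               (λ v∈p v∈q → p#q (there v∈p) (there v∈q))
  with x | y | z
... | inside  | inside  | _       = contradiction here (p#q here)
... | inside  | outside | outside = case p⊆r here of λ ()
... | inside  | outside | inside  = s≤s rec
... | outside | inside  | outside = case q⊆r here of λ ()
... | outside | inside  | inside  = ≤-trans (≤-reflexive (+-suc ∣ p ∣ ∣ q ∣)) (s≤s rec)
... | outside | outside | outside = rec
... | outside | outside | inside  = m≤n⇒m≤1+n rec

∣p++q∣≡∣p∣+∣q∣ : (p : Subset m) (q : Subset n) → ∣ p ++ q ∣ ≡ ∣ p ∣ + ∣ q ∣
∣p++q∣≡∣p∣+∣q∣ []            q = refl
∣p++q∣≡∣p∣+∣q∣ (outside ∷ p) q = ∣p++q∣≡∣p∣+∣q∣ p q
∣p++q∣≡∣p∣+∣q∣ (inside  ∷ p) q = cong suc (∣p++q∣≡∣p∣+∣q∣ p q)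

initial : ℕ → Subset m
initial c = comprehension (λ v → toℕ v <? c)

-- Only an inequality, since `c` may exceed `m`.
∣initial∣≤ : ∀ m c → ∣ initial {m} c ∣ ≤ c
∣initial∣≤ zero    c       = z≤n
∣initial∣≤ (suc m) zero    = ∣initial∣≤ m zero
∣initial∣≤ (suc m) (suc c) = s≤s (∣initial∣≤ m c)

-- Parity of distances.

parity-∣-∣ : ∀ m n → parity ∣ m - n ∣ ≡ parity m ⊕ parity n
parity-∣-∣ zero    n       = refl
parity-∣-∣ (suc m) zero    = sym (ℙ.+-identityʳ (parity (suc m)))
-- Removing a successor on both sides flips both parities, and the two flips cancel.
parity-∣-∣ (suc m) (suc n) = trans (parity-∣-∣ m n)
  (trans (cong₂ _⊕_ (sym (ℙ.suc-homo-⁻¹ m)) (sym (ℙ.suc-homo-⁻¹ n)))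
         (⁻¹-⊕-⁻¹ (parity (suc m)) (parity (suc n))))
  where
  ⁻¹-⊕-⁻¹ : ∀ p q → p ⁻¹ ⊕ q ⁻¹ ≡ p ⊕ q
  ⁻¹-⊕-⁻¹ 0ℙ q = ℙ.⁻¹-involutive q
  ⁻¹-⊕-⁻¹ 1ℙ q = refl

2∣⇒parity≡0 : ∀ {n} → 2 ∣ n → parity n ≡ 0ℙ
2∣⇒parity≡0 (divides q refl) = parity-*2 q
  where
  parity-*2 : ∀ q → parity (q * 2) ≡ 0ℙ
  parity-*2 zero    = refl
  parity-*2 (suc q) = parity-*2 q

parity≡0⇒2∣ : ∀ n → parity n ≡ 0ℙ → 2 ∣ n
parity≡0⇒2∣ zero          _  = divides 0 refl
parity≡0⇒2∣ (suc (suc n)) eq = ∣m∣n⇒∣m+n ∣-refl (parity≡0⇒2∣ n eq)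

⊕≡0⇒≡ : ∀ p q → p ⊕ q ≡ 0ℙ → p ≡ q
⊕≡0⇒≡ 0ℙ 0ℙ _ = refl
⊕≡0⇒≡ 1ℙ 1ℙ _ = refl

≢⇒≡⁻¹ : ∀ {p q : Parity} → ¬ p ≡ q → p ≡ q ⁻¹
≢⇒≡⁻¹ {0ℙ} {0ℙ} p≢q = contradiction refl p≢q
≢⇒≡⁻¹ {0ℙ} {1ℙ} p≢q = refl
≢⇒≡⁻¹ {1ℙ} {0ℙ} p≢q = refl
≢⇒≡⁻¹ {1ℙ} {1ℙ} p≢q = contradiction refl p≢q

-- The two parity classes.

class : Parity → Subset m
class q = comprehension (λ v → parity (toℕ v) ℙ.≟ q)

class⁺ : ∀ {q} {v : Fin m} → parity (toℕ v) ≡ q → v ∈ class q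
class⁺ {q = q} = ∈-comprehension⁺ (λ v → parity (toℕ v) ℙ.≟ q)

class⁻ : ∀ {q} {v : Fin m} → v ∈ class q → parity (toℕ v) ≡ q
class⁻ {q = q} = ∈-comprehension⁻ (λ v → parity (toℕ v) ℙ.≟ q)

∣class∩∣+∣class⁻¹∩∣≤∣∣ : ∀ q (D : Subset m) → ∣ class q ∩ D ∣ + ∣ class (q ⁻¹) ∩ D ∣ ≤ ∣ D ∣
∣class∩∣+∣class⁻¹∩∣≤∣∣ q D = disjoint⇒∣p∣+∣q∣≤∣r∣ _ _ D
  (proj₂ ∘ x∈p∩q⁻ _ D) (proj₂ ∘ x∈p∩q⁻ _ D)
  λ v∈p v∈q → ℙ.p≢p⁻¹ q (trans (sym (class⁻ (proj₁ (x∈p∩q⁻ _ D v∈p))))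
                               (class⁻ (proj₁ (x∈p∩q⁻ _ D v∈q))))

-- The induction removes two consecutive vertices at a time; exactly one of them has parity `q`, and
-- the parities of the rest are unchanged.
class-initial≤ : ∀ h → h * 2 ≤ m → ∀ q (S : Subset m) →
                 (∀ v → toℕ v < h * 2 → parity (toℕ v) ≡ q → v ∈ S) → h ≤ ∣ S ∣
class-initial≤ zero    _               q S           _  = z≤n
class-initial≤ (suc h) (s≤s (s≤s h≤m)) q (x ∷ y ∷ S) ∈S
  with rec ← class-initial≤ h h≤m q S
               (λ v v< eq → drop-there (drop-there (∈S (suc (suc v)) (s≤s (s≤s v<)) eq)))
  with q | x | y
... | 0ℙ | inside  | inside  = s≤s (m≤n⇒m≤1+n rec)
... | 0ℙ | inside  | outside = s≤s rec
... | 0ℙ | outside | _       = case ∈S zero (s≤s z≤n) refl of λ ()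
... | 1ℙ | inside  | inside  = s≤s (m≤n⇒m≤1+n rec)
... | 1ℙ | outside | inside  = s≤s rec
... | 1ℙ | _       | outside = case ∈S (suc zero) (s≤s (s≤s z≤n)) refl of λ { (there ()) }

-- Overlaying the two halves of `S` identifies each vertex with its partner, so the union of the
-- halves contains every vertex of parity `q` in `Fin n`.
class-pairs≤ : ∀ h → h * 2 ≤ n → ∀ q (S : Subset (n + n)) →
               (∀ v → parity (toℕ v) ≡ q → v ↑ˡ n ∈ S ⊎ n ↑ʳ v ∈ S) → h ≤ ∣ S ∣
class-pairs≤ {n} h h≤n q S ∈S with splitAt n S
... | L , R , refl = begin
  h             ≤⟨ class-initial≤ h h≤n q (L ∪ R) (λ v _ eq → x∈p∪q⁺ (∈L⊎∈R v (∈S v eq))) ⟩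
  ∣ L ∪ R ∣     ≤⟨ ∣p∪q∣≤∣p∣+∣q∣ L R ⟩
  ∣ L ∣ + ∣ R ∣ ≡⟨ ∣p++q∣≡∣p∣+∣q∣ L R ⟨
  ∣ L ++ R ∣    ∎
  where
  open ≤-Reasoning
  ∈L⊎∈R : ∀ v → v ↑ˡ n ∈ L ++ R ⊎ n ↑ʳ v ∈ L ++ R → v ∈ L ⊎ v ∈ R
  ∈L⊎∈R v (inj₁ ∈L) = inj₁ (lookup⇒[]= v L (trans (sym (lookup-++ˡ L R v)) ([]=⇒lookup ∈L)))
  ∈L⊎∈R v (inj₂ ∈R) = inj₂ (lookup⇒[]= v R (trans (sym (lookup-++ʳ L R v)) ([]=⇒lookup ∈R)))

-- Partners: vertices at distance `n`.

∣m-n∣≡d⇒ : ∀ m n {d} → ∣ m - n ∣ ≡ d → m ≡ n + d ⊎ n ≡ m + d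
∣m-n∣≡d⇒ zero    n       refl = inj₂ refl
∣m-n∣≡d⇒ (suc m) zero    refl = inj₁ refl
∣m-n∣≡d⇒ (suc m) (suc n) eq with ∣m-n∣≡d⇒ m n eq
... | inj₁ m≡ = inj₁ (cong suc m≡)
... | inj₂ n≡ = inj₂ (cong suc n≡)

partner-unique : ∀ (v u w : Fin (n + n)) → ∣ toℕ v - toℕ u ∣ ≡ n → ∣ toℕ v - toℕ w ∣ ≡ n → u ≡ w
partner-unique {n} v u w vu vw = Fin.toℕ-injective
  (unique (∣m-n∣≡d⇒ (toℕ v) (toℕ u) vu) (∣m-n∣≡d⇒ (toℕ v) (toℕ w) vw))
  where
  -- Partners on both sides of `v` would be `n + n` apart, which does not fit into `Fin (n + n)`.
  too-far : ∀ (x y : Fin (n + n)) → toℕ v ≡ toℕ x + n → ¬ toℕ y ≡ toℕ v + n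
  too-far x y v≡ y≡ = <⇒≱ (Fin.toℕ<n y) (begin
    n + n           ≤⟨ +-monoˡ-≤ n (m≤n+m n (toℕ x)) ⟩
    toℕ x + n + n   ≡⟨ cong (_+ n) v≡ ⟨
    toℕ v + n       ≡⟨ y≡ ⟨
    toℕ y           ∎)
    where open ≤-Reasoning

  unique : toℕ v ≡ toℕ u + n ⊎ toℕ u ≡ toℕ v + n →
           toℕ v ≡ toℕ w + n ⊎ toℕ w ≡ toℕ v + n → toℕ u ≡ toℕ w
  unique (inj₁ a) (inj₁ b) = +-cancelʳ-≡ n _ _ (trans (sym a) b)
  unique (inj₁ a) (inj₂ b) = contradiction b (too-far u w a)
  unique (inj₂ a) (inj₁ b) = contradiction a (too-far w u b)
  unique (inj₂ a) (inj₂ b) = trans a (sym b)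

-- Adjacency in terms of parity, and the upper bound.

G : ∀ m n → Graph m
G m n = toeplitz m (oddOr? n)

opposite⇒Adj : ∀ {u v : Fin m} → parity (toℕ u) ≡ parity (toℕ v) ⁻¹ → Adj (G m n) v u
opposite⇒Adj {u = u} {v} u≡v⁻¹ =
    (λ { refl → ℙ.p≢p⁻¹ _ u≡v⁻¹ })
  , inj₁ λ 2∣ → ℙ.p≢p⁻¹ _ (trans
      (⊕≡0⇒≡ _ _ (trans (sym (parity-∣-∣ (toℕ v) (toℕ u))) (2∣⇒parity≡0 2∣))) u≡v⁻¹)

Adj⇒opposite⊎partner : ∀ {u v : Fin m} → Adj (G m n) v u →
                       parity (toℕ u) ≡ parity (toℕ v) ⁻¹ ⊎ ∣ toℕ v - toℕ u ∣ ≡ n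
Adj⇒opposite⊎partner (_ , inj₂ eq) = inj₂ eq
Adj⇒opposite⊎partner {u = u} {v} (_ , inj₁ odd) = inj₁ (≢⇒≡⁻¹ λ u≡v → odd
  (parity≡0⇒2∣ _ (trans (parity-∣-∣ (toℕ v) (toℕ u))
    (trans (cong (parity (toℕ v) ⊕_) u≡v) (ℙ.p+p≡0ℙ (parity (toℕ v)))))))

-- Every vertex, inside the set or not, is adjacent to the `k` members of `initial (k * 2)` that lie
-- in the opposite class.
initial-KDominating : k * 2 ≤ m → KDominating (G m n) k (initial (k * 2))
initial-KDominating {k} {m} {n} k≤m v _ =
  class-initial≤ k k≤m (parity (toℕ v) ⁻¹) _ λ u u< eq →
    x∈p∩q⁺ ( ∈-comprehension⁺ (adj? (G m n) v) (opposite⇒Adj eq)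
           , ∈-comprehension⁺ (λ w → toℕ w <? k * 2) u<)

-- Counting the neighbours of a vertex outside `D`.

module _ {D : Subset (n + n)} (dom : KDominating (G (n + n) n) k D)
         {v : Fin (n + n)} (v∉D : v ∉ D) where

  private
    q = parity (toℕ v) ⁻¹

    N∩D⊆ : ∀ {u} → u ∈ neighbours (G (n + n) n) v ∩ D →
           u ∈ class q ∩ D ⊎ (u ∈ D × ∣ toℕ v - toℕ u ∣ ≡ n)
    N∩D⊆ u∈ with x∈p∩q⁻ _ D u∈
    ... | u∈N , u∈D with Adj⇒opposite⊎partner (∈-comprehension⁻ (adj? (G (n + n) n) v) u∈N)
    ... | inj₁ eq = inj₁ (x∈p∩q⁺ (class⁺ eq , u∈D))
    ... | inj₂ eq = inj₂ (u∈D , eq)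

  partner∉D⇒k≤ : (∀ u → ∣ toℕ v - toℕ u ∣ ≡ n → u ∉ D) → k ≤ ∣ class q ∩ D ∣
  partner∉D⇒k≤ ∉D = ≤-trans (dom v v∉D) (p⊆q⇒∣p∣≤∣q∣ λ u∈ → case N∩D⊆ u∈ of λ where
    (inj₁ u∈C)       → u∈C
    (inj₂ (u∈D , e)) → contradiction u∈D (∉D _ e))

  -- Outside the class `q` opposite to `v`, only the partner of `v` can be a neighbour, and it
  -- contributes at most one.
  k≤1+ : k ≤ suc ∣ class q ∩ D ∣
  k≤1+ with Fin.any? (λ u → ∣ toℕ v - toℕ u ∣ ≟ℕ n)
  ... | no ∄ = m≤n⇒m≤1+n (partner∉D⇒k≤ λ u e → contradiction (u , e) ∄)
  ... | yes (w , vw) = begin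
    k                                        ≤⟨ dom v v∉D ⟩
    ∣ neighbours (G (n + n) n) v ∩ D ∣       ≤⟨ p⊆q⇒∣p∣≤∣q∣ (x∈p∪q⁺ ∘ ⊆w ∘ N∩D⊆) ⟩
    ∣ ⁅ w ⁆ ∪ (class q ∩ D) ∣                ≤⟨ ∣p∪q∣≤∣p∣+∣q∣ ⁅ w ⁆ _ ⟩
    ∣ ⁅ w ⁆ ∣ + ∣ class q ∩ D ∣              ≡⟨ cong (_+ _) (∣⁅x⁆∣≡1 w) ⟩
    suc ∣ class q ∩ D ∣                      ∎
    where
    open ≤-Reasoning
    ⊆w : ∀ {u} → u ∈ class q ∩ D ⊎ (u ∈ D × ∣ toℕ v - toℕ u ∣ ≡ n) →
         u ∈ ⁅ w ⁆ ⊎ u ∈ class q ∩ D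
    ⊆w (inj₁ u∈) = inj₂ u∈
    ⊆w {u} (inj₂ (_ , vu)) with refl ← partner-unique v u w vu vw = inj₁ (x∈⁅x⁆ u)

-- The lower bound.

module _ {h : ℕ} {D : Subset (h * 2 + h * 2)}
         (dom : KDominating (G (h * 2 + h * 2) (h * 2)) k D) where

  private
    N = h * 2

  -- If `D` missed both ends of a matching edge in class `q`, either end would need `k` neighbours
  -- in the opposite class, which has fewer in `D`.
  h≤∣class∩D∣ : ∀ q → ∣ class (q ⁻¹) ∩ D ∣ < k → h ≤ ∣ class q ∩ D ∣
  h≤∣class∩D∣ q b<k = class-pairs≤ h ≤-refl q _ meets
    where
    meets : ∀ (v : Fin N) → parity (toℕ v) ≡ q →
            v ↑ˡ N ∈ class q ∩ D ⊎ N ↑ʳ v ∈ class q ∩ D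
    meets v refl with v ↑ˡ N ∈? D | N ↑ʳ v ∈? D
    ... | yes ∈D | _ = inj₁ (x∈p∩q⁺ (class⁺ (cong parity (Fin.toℕ-↑ˡ v N)) , ∈D))
    ... | no _ | yes ∈D = inj₂ (x∈p∩q⁺ (class⁺ eq , ∈D))
      where
      -- Since `N` is even, partners lie in the same class.
      eq : parity (toℕ (N ↑ʳ v)) ≡ parity (toℕ v)
      eq = trans (cong parity (Fin.toℕ-↑ʳ N v)) (trans (ℙ.+-homo-+ N (toℕ v))
             (cong (_⊕ parity (toℕ v)) (2∣⇒parity≡0 (divides h refl))))
    ... | no ∉D | no ∉D′ = contradiction
      (partner∉D⇒k≤ {n = N} dom ∉D λ u e → subst (_∉ D) (partner-unique (v ↑ˡ N) (N ↑ʳ v) u eq e) ∉D′)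
      (<⇒≱ (subst (λ x → ∣ class (parity x ⁻¹) ∩ D ∣ < k) (sym (Fin.toℕ-↑ˡ v N)) b<k))
      where
      eq : ∣ toℕ (v ↑ˡ N) - toℕ (N ↑ʳ v) ∣ ≡ N
      eq = trans (cong₂ ∣_-_∣ (Fin.toℕ-↑ˡ v N) (trans (Fin.toℕ-↑ʳ N v) (+-comm N (toℕ v))))
                 (∣m-m+n∣≡n (toℕ v) N)

  small-class⇒k+k≤ : k < h → ∀ q → ∣ class (q ⁻¹) ∩ D ∣ < k →
                     k + k ≤ ∣ class q ∩ D ∣ + ∣ class (q ⁻¹) ∩ D ∣
  small-class⇒k+k≤ k<h q b<k
    with Fin.any? (λ v → parity (toℕ v) ℙ.≟ q ×-dec ¬? (v ∈? D))
  -- The class of `v` exceeds `k` by one, which makes up for the one that `k≤1+` may lose in the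
  -- other class; hence the bound is shown with a successor on both sides.
  ... | yes (v , refl , v∉D) = s≤s⁻¹ (begin
    suc k + k                                     ≤⟨ +-mono-≤ k<∣class∩D∣ (k≤1+ {n = N} dom v∉D) ⟩
    ∣ class q ∩ D ∣ + suc ∣ class (q ⁻¹) ∩ D ∣    ≡⟨ +-suc _ _ ⟩
    suc (∣ class q ∩ D ∣ + ∣ class (q ⁻¹) ∩ D ∣)  ∎)
    where
    open ≤-Reasoning
    k<∣class∩D∣ = ≤-trans k<h (h≤∣class∩D∣ q b<k)
  -- Here `D` contains all of class `q`, which has `N` vertices.
  ... | no ∄ = begin
    k + k                                   ≤⟨ +-mono-≤ (<⇒≤ k<h) (<⇒≤ k<h) ⟩
    h + h                                   ≡⟨ n*2≡n+n h ⟨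
    N                                       ≤⟨ class-initial≤ N (≤-reflexive (n*2≡n+n N)) q _ class⊆ ⟩
    ∣ class q ∩ D ∣                         ≤⟨ m≤m+n _ _ ⟩
    ∣ class q ∩ D ∣ + ∣ class (q ⁻¹) ∩ D ∣  ∎
    where
    open ≤-Reasoning
    n*2≡n+n : ∀ n → n * 2 ≡ n + n
    n*2≡n+n n = trans (*-comm n 2) (cong (n +_) (+-identityʳ n))
    class⊆ : ∀ v → toℕ v < N * 2 → parity (toℕ v) ≡ q → v ∈ class q ∩ D
    class⊆ v _ eq =
      x∈p∩q⁺ (class⁺ eq , decidable-stable (v ∈? D) λ v∉D → ∄ (v , eq , v∉D))

  k+k≤∣D∣ : k < h → k + k ≤ ∣ D ∣
  k+k≤∣D∣ k<h with k ≤? ∣ class 0ℙ ∩ D ∣ | k ≤? ∣ class 1ℙ ∩ D ∣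
  ... | yes k≤a | yes k≤b = ≤-trans (+-mono-≤ k≤a k≤b) (∣class∩∣+∣class⁻¹∩∣≤∣∣ 0ℙ D)
  -- The parity passed on is that of the other class; its inverse is the small one.
  ... | no  k≰a | _       = ≤-trans (small-class⇒k+k≤ k<h 1ℙ (≰⇒> k≰a)) (∣class∩∣+∣class⁻¹∩∣≤∣∣ 1ℙ D)
  ... | yes _   | no  k≰b = ≤-trans (small-class⇒k+k≤ k<h 0ℙ (≰⇒> k≰b)) (∣class∩∣+∣class⁻¹∩∣≤∣∣ 0ℙ D)

-- The order `m` is a variable, so that `2 * n`, which unfolds to `n + (n + 0)`, can be replaced by
-- `n + n` through matching on `refl`.
γ≡2k : ∀ h → k < h → m ≡ h * 2 + h * 2 → γ (G m (h * 2)) k ≡ 2 * k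
γ≡2k {k} h k<h refl with γ-isKDominationNumber (G (h * 2 + h * 2) (h * 2)) k
... | (D , dom , ∣D∣≡γ) , minimal = ≤-antisym
  (≤-trans (minimal (initial (k * 2)) (initial-KDominating k*2≤))
           (≤-trans (∣initial∣≤ (h * 2 + h * 2) (k * 2)) (≤-reflexive (*-comm k 2))))
  (≤-trans (≤-reflexive (cong (k +_) (+-identityʳ k)))
           (≤-trans (k+k≤∣D∣ {h = h} dom k<h) (≤-reflexive ∣D∣≡γ)))
  where
  k*2≤ : k * 2 ≤ h * 2 + h * 2
  k*2≤ = ≤-trans (*-monoˡ-≤ 2 (<⇒≤ k<h)) (m≤m+n _ _)

theorem3p15 : (n : ℕ) → 4 ≤ n → 2 ∣ n → (k : ℕ) → 1 < k → k ≤ n / 2 ∸ 1 → γ (T n) k ≡ 2 * k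
theorem3p15 _ _ (divides h refl) k 1<k k≤ =
  γ≡2k h (k<h h (subst (λ x → k ≤ x ∸ 1) (m*n/n≡m h 2) k≤))
    (cong (h * 2 +_) (+-identityʳ (h * 2)))
  where
  k<h : ∀ h → k ≤ h ∸ 1 → k < h
  -- Truncated subtraction turns the bound into `k ≤ 0` here, against `1 < k`.
  k<h zero    k≤0 = contradiction (<-≤-trans 1<k k≤0) λ ()
  k<h (suc h) k≤h = s≤s k≤h
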